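{- Let $\mathbb{A}$ and $\mathbb{B}$ be sets of pointed Kripke-models for $\Phi$ and let $m$ and $k$ be natural numbers. Then the following conditions are equivalent: (1) Player S has a winning strategy in the formula size game $\mathrm{FS}_{m,k}(\mathbb{A},\mathbb{B})$. (2) There is a formula $\varphi\in\mathrm{ML}(\Phi)$ such that $\mathrm{ms}(\varphi)\le m$, $\mathrm{cs}(\varphi)\le k$ and $\varphi$ separates the sets $\mathbb{A}$ and $\mathbb{B}$.
   Context: Natural numbers include $0$. $\Phi$ is a set of proposition symbols. A pointed Kripke-model for $\Phi$ is a pair $(\mathcal{M},w)$ with $\mathcal{M}=(W,R,V)$, $R\subseteq W\times W$, $V:\Phi\to\mathcal{P}(W)$, $w\in W$. Formulas of $\mathrm{ML}(\Phi)$ (in negation normal form) are generated by $\varphi:=p\mid\neg p\mid(\varphi\wedge\varphi)\mid(\varphi\vee\varphi)\mid\Diamond\varphi\mid\Box\varphi$, $p\in\Phi$, with the usual Kripke semantics; the formulas $p,\neg p$ are the literals. (In the case $\Phi=\emptyset$ the constants $\top$, which is always true, and $\bot$, which is always false, are added and are the literals.) Modal size: $\mathrm{ms}(\varphi)=0$ for literals, $\mathrm{ms}(\psi\vee\vartheta)=\mathrm{ms}(\psi\wedge\vartheta)=\mathrm{ms}(\psi)+\mathrm{ms}(\vartheta)$, $\mathrm{ms}(\Diamond\psi)=\mathrm{ms}(\Box\psi)=\mathrm{ms}(\psi)+1$. Binary connective size: $\mathrm{cs}(\varphi)=0$ for literals, $\mathrm{cs}(\psi\vee\vartheta)=\mathrm{cs}(\psi\wedge\vartheta)=\mathrm{cs}(\psi)+\mathrm{cs}(\vartheta)+1$,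 $\mathrm{cs}(\Diamond\psi)=\mathrm{cs}(\Box\psi)=\mathrm{cs}(\psi)$. A formula $\varphi$ separates $\mathbb{A}$ and $\mathbb{B}$ if every element of $\mathbb{A}$ satisfies $\varphi$ and no element of $\mathbb{B}$ satisfies $\varphi$. Notation: $\Box(\mathcal{M},w)=\{(\mathcal{M},v)\mid wR^{\mathcal{M}}v\}$; $\Box\mathbb{A}=\bigcup_{(\mathcal{M},w)\in\mathbb{A}}\Box(\mathcal{M},w)$; for $f:\mathbb{A}\to\Box\mathbb{A}$ with $f(\mathcal{M},w)\in\Box(\mathcal{M},w)$ for all $(\mathcal{M},w)\in\mathbb{A}$, $\Diamond_f\mathbb{A}=f(\mathbb{A})$. The formula size game $\mathrm{FS}_{m_0,k_0}(\mathbb{A}_0,\mathbb{B}_0)$ has players S and D and starting position $(m_0,k_0,\mathbb{A}_0,\mathbb{B}_0)$. The game ends and S wins in a position $(m,k,\mathbb{A},\mathbb{B})$ if some literal separates $\mathbb{A}$ and $\mathbb{B}$. The game ends and D wins in a position with $m=k=0$ in which S does not win. Otherwise, in position $(m,k,\mathbb{A},\mathbb{B})$, S chooses one of the following moves (all parameters must be natural numbers). - Left splitting move: S chooses natural numbers $m_1,m_2,k_1,k_2$ and sets $\mathbb{A}_1,\mathbb{A}_2$ with $m_1+m_2=m$, $k_1+k_2+1=k$, $\mathbb{A}_1\cup\mathbb{A}_2=\mathbb{A}$; then D decides whether the game continues from $(m_1,k_1,\mathbb{A}_1,\mathbb{B})$ or from $(m_2,k_2,\mathbb{A}_2,\mathbb{B})$.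 - Right splitting move: S chooses natural numbers $m_1,m_2,k_1,k_2$ and sets $\mathbb{B}_1,\mathbb{B}_2$ with $m_1+m_2=m$, $k_1+k_2+1=k$, $\mathbb{B}_1\cup\mathbb{B}_2=\mathbb{B}$; then D decides whether the game continues from $(m_1,k_1,\mathbb{A},\mathbb{B}_1)$ or from $(m_2,k_2,\mathbb{A},\mathbb{B}_2)$. - Left successor move (needs $m\ge1$): S chooses $f:\mathbb{A}\to\Box\mathbb{A}$ with $f(\mathcal{A},w)\in\Box(\mathcal{A},w)$ for all $(\mathcal{A},w)\in\mathbb{A}$; the game continues from $(m-1,k,\Diamond_f\mathbb{A},\Box\mathbb{B})$. - Right successor move (needs $m\ge1$): S chooses $g:\mathbb{B}\to\Box\mathbb{B}$ with $g(\mathcal{B},w)\in\Box(\mathcal{B},w)$ for all $(\mathcal{B},w)\in\mathbb{B}$; the game continues from $(m-1,k,\Box\mathbb{A},\Diamond_g\mathbb{B})$. If $\Box(\mathcal{M},w)=\emptyset$ for some $(\mathcal{M},w)\in\mathbb{A}$ (resp. $\mathbb{B}$), S cannot make a left (resp. right) successor move. If S has not won and has no legal move, D wins. -}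

module Defs where

open import Data.Bool.Base using (Bool; true; false)
open import Data.Maybe.Base using (Maybe; just; nothing)
open import Data.Nat.Base using (ℕ; suc; _+_)
open import Data.Product.Base using (Σ-syntax; ∃-syntax; _×_)
open import Data.Sum.Base using (_⊎_)
import Data.Empty.Polymorphic as Poly
import Data.Unit.Polymorphic as Poly
open import Data.Unit.Base using (⊤)
open import Level using (Level) renaming (suc to lsuc; _⊔_ to _⊔ˡ_)
open import Relation.Binary.Core using (Rel)
open import Relation.Binary.PropositionalEquality.Core using (_≡_)
open import Relation.Nullary.Negation.Core using (¬_)
open import Relation.Unary using (Pred; _∈_; _∪_; _≐_)

record KripkeModel {a} (Φ : Set a) (ℓ : Level) : Set (a ⊔ˡ lsuc ℓ) where
  field
    W : Set ℓ
    R : Rel W ℓ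
    V : Φ → Pred W ℓ

open KripkeModel public

record PointedModel {a} (Φ : Set a) (ℓ : Level) : Set (a ⊔ˡ lsuc ℓ) where
  constructor _,_
  field
    model : KripkeModel Φ ℓ
    point : W model

infixr 4 _,_

-- The level is chosen so that these sets are closed under images of
-- functions on pointed models.
ModelSet : ∀ {a} (Φ : Set a) (ℓ : Level) → Set (lsuc (a ⊔ˡ lsuc ℓ))
ModelSet {a} Φ ℓ = Pred (PointedModel Φ ℓ) (a ⊔ˡ lsuc ℓ)

-- The constants are available exactly when there are no proposition
-- symbols.
data Literal {a} (Φ : Set a) : Set a where
  pos neg : Φ → Literal Φ
  top bot : ¬ Φ → Literal Φ

infixr 6 _∧_
infixr 5 _∨_

data ML {a} (Φ : Set a) : Set a where
  lit     : Literal Φ → ML Φ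
  _∧_ _∨_ : ML Φ → ML Φ → ML Φ
  ◇ □     : ML Φ → ML Φ

module _ {a : Level} {Φ : Set a} where

  ms : ML Φ → ℕ
  ms (lit l) = 0
  ms (ψ ∧ ϑ) = ms ψ + ms ϑ
  ms (ψ ∨ ϑ) = ms ψ + ms ϑ
  ms (◇ ψ)   = ms ψ + 1
  ms (□ ψ)   = ms ψ + 1

  cs : ML Φ → ℕ
  cs (lit l) = 0
  cs (ψ ∧ ϑ) = cs ψ + cs ϑ + 1
  cs (ψ ∨ ϑ) = cs ψ + cs ϑ + 1
  cs (◇ ψ)   = cs ψ
  cs (□ ψ)   = cs ψ

module _ {a ℓ : Level} {Φ : Set a} where

  infix 4 _⊨ˡ_ _⊨_

  _⊨ˡ_ : PointedModel Φ ℓ → Literal Φ → Set ℓ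
  (M , w) ⊨ˡ pos p = w ∈ V M p
  (M , w) ⊨ˡ neg p = ¬ (w ∈ V M p)
  (M , w) ⊨ˡ top _ = Poly.⊤
  (M , w) ⊨ˡ bot _ = Poly.⊥

  _⊨_ : PointedModel Φ ℓ → ML Φ → Set ℓ
  (M , w) ⊨ lit l   = (M , w) ⊨ˡ l
  (M , w) ⊨ (ψ ∧ ϑ) = ((M , w) ⊨ ψ) × ((M , w) ⊨ ϑ)
  (M , w) ⊨ (ψ ∨ ϑ) = ((M , w) ⊨ ψ) ⊎ ((M , w) ⊨ ϑ)
  (M , w) ⊨ ◇ ψ     = Σ[ v ∈ W M ] (R M w v × ((M , v) ⊨ ψ))
  (M , w) ⊨ □ ψ     = ∀ v → R M w v → (M , v) ⊨ ψ

  Separates : ML Φ → ModelSet Φ ℓ → ModelSet Φ ℓ → Set (a ⊔ˡ lsuc ℓ)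
  Separates φ A B = (∀ x → x ∈ A → x ⊨ φ) × (∀ x → x ∈ B → ¬ (x ⊨ φ))

  data □ₚ : PointedModel Φ ℓ → ModelSet Φ ℓ where
    succ : ∀ {M w v} → R M w v → (M , v) ∈ □ₚ (M , w)

  □ₛ : ModelSet Φ ℓ → ModelSet Φ ℓ
  □ₛ A y = ∃[ x ] (x ∈ A × y ∈ □ₚ x)

  -- A choice function on A is represented by a total function on pointed
  -- models; only its values on A are constrained here and used in ◇ₛ.
  IsSuccessorFunction : (PointedModel Φ ℓ → PointedModel Φ ℓ) →
                        ModelSet Φ ℓ → Set (a ⊔ˡ lsuc ℓ)
  IsSuccessorFunction f A = ∀ x → x ∈ A → f x ∈ □ₚ x

  ◇ₛ : (PointedModel Φ ℓ → PointedModel Φ ℓ) → ModelSet Φ ℓ → ModelSet Φ ℓ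
  ◇ₛ f A y = ∃[ x ] (x ∈ A × y ≡ f x)

record Position {a} (Φ : Set a) (ℓ : Level) : Set (lsuc (a ⊔ˡ lsuc ℓ)) where
  constructor ⟨_,_,_,_⟩
  field
    modal      : ℕ
    connective : ℕ
    left right : ModelSet Φ ℓ

module _ {a ℓ : Level} {Φ : Set a} where

  EndsWithSWin : Position Φ ℓ → Set (a ⊔ˡ lsuc ℓ)
  EndsWithSWin ⟨ _ , _ , A , B ⟩ = ∃[ l ] Separates (lit l) A B

  EndsWithDWin : Position Φ ℓ → Set (a ⊔ˡ lsuc ℓ)
  EndsWithDWin p@(⟨ m , k , _ , _ ⟩) = m ≡ 0 × k ≡ 0 × ¬ EndsWithSWin p

  Ended : Position Φ ℓ → Set (a ⊔ˡ lsuc ℓ)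
  Ended p = EndsWithSWin p ⊎ EndsWithDWin p

  data Move : Position Φ ℓ → Set (lsuc (a ⊔ˡ lsuc ℓ)) where
    leftSplit  : ∀ {m k A B} (m₁ m₂ k₁ k₂ : ℕ) (A₁ A₂ : ModelSet Φ ℓ) →
                 m₁ + m₂ ≡ m → k₁ + k₂ + 1 ≡ k → A₁ ∪ A₂ ≐ A →
                 Move ⟨ m , k , A , B ⟩
    rightSplit : ∀ {m k A B} (m₁ m₂ k₁ k₂ : ℕ) (B₁ B₂ : ModelSet Φ ℓ) →
                 m₁ + m₂ ≡ m → k₁ + k₂ + 1 ≡ k → B₁ ∪ B₂ ≐ B →
                 Move ⟨ m , k , A , B ⟩
    leftSucc   : ∀ {m k A B} (f : PointedModel Φ ℓ → PointedModel Φ ℓ) →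
                 IsSuccessorFunction f A → Move ⟨ suc m , k , A , B ⟩
    rightSucc  : ∀ {m k A B} (g : PointedModel Φ ℓ → PointedModel Φ ℓ) →
                 IsSuccessorFunction g B → Move ⟨ suc m , k , A , B ⟩

  Reply : ∀ {p} → Move p → Set
  Reply (leftSplit  _ _ _ _ _ _ _ _ _) = Bool
  Reply (rightSplit _ _ _ _ _ _ _ _ _) = Bool
  Reply (leftSucc  _ _)                = ⊤
  Reply (rightSucc _ _)                = ⊤

  next : ∀ {p} (μ : Move p) → Reply μ → Position Φ ℓ
  next (leftSplit {B = B} m₁ m₂ k₁ k₂ A₁ A₂ _ _ _) true   = ⟨ m₁ , k₁ , A₁ , B ⟩
  next (leftSplit {B = B} m₁ m₂ k₁ k₂ A₁ A₂ _ _ _) false  = ⟨ m₂ , k₂ , A₂ , B ⟩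
  next (rightSplit {A = A} m₁ m₂ k₁ k₂ B₁ B₂ _ _ _) true  = ⟨ m₁ , k₁ , A , B₁ ⟩
  next (rightSplit {A = A} m₁ m₂ k₁ k₂ B₁ B₂ _ _ _) false = ⟨ m₂ , k₂ , A , B₂ ⟩
  next (leftSucc  {m} {k} {A} {B} f _) _ = ⟨ m , k , ◇ₛ f A , □ₛ B ⟩
  next (rightSucc {m} {k} {A} {B} g _) _ = ⟨ m , k , □ₛ A , ◇ₛ g B ⟩

  data Play (p₀ : Position Φ ℓ) : Position Φ ℓ → Set (lsuc (a ⊔ˡ lsuc ℓ)) where
    start  : Play p₀ p₀
    extend : ∀ {p} → Play p₀ p → ¬ Ended p →
             (μ : Move p) (r : Reply μ) → Play p₀ (next μ r)

  -- A strategy for S may depend on the whole play so far.  The value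
  -- nothing means that S makes no move; it is forced when S has no legal
  -- move, and such a play is lost unless S has already won.
  Strategy : Position Φ ℓ → Set (lsuc (a ⊔ˡ lsuc ℓ))
  Strategy p₀ = ∀ p → Play p₀ p → Maybe (Move p)

  data Follows {p₀} (σ : Strategy p₀) : ∀ {p} → Play p₀ p →
               Set (lsuc (a ⊔ˡ lsuc ℓ)) where
    start  : Follows σ start
    extend : ∀ {p} {π : Play p₀ p} {μ : Move p} → Follows σ π →
             (¬ended : ¬ Ended p) → σ p π ≡ just μ → (r : Reply μ) →
             Follows σ (extend π ¬ended μ r)

  Complete : ∀ {p₀ p} → Strategy p₀ → Play p₀ p → Set (lsuc (a ⊔ˡ lsuc ℓ))
  Complete {p = p} σ π = Ended p ⊎ σ p π ≡ nothing

  -- There are no infinite plays, since every move decreases the sum of the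
  -- two resource parameters of the position.
  Winning : ∀ {p₀} → Strategy p₀ → Set (lsuc (a ⊔ˡ lsuc ℓ))
  Winning {p₀} σ = ∀ p (π : Play p₀ p) → Follows σ π → Complete σ π →
                   EndsWithSWin p

  SHasWinningStrategy : Position Φ ℓ → Set (lsuc (a ⊔ˡ lsuc ℓ))
  SHasWinningStrategy p₀ = Σ[ σ ∈ Strategy p₀ ] Winning σ

  -- The initial position determines the game.
  FS : ℕ → ℕ → ModelSet Φ ℓ → ModelSet Φ ℓ → Position Φ ℓ
  FS m k A B = ⟨ m , k , A , B ⟩

{-# OPTIONS --safe #-}

-- A winning strategy for S is the construction of a separating formula from
-- its main connective inwards: left and right splits are disjunctions and
-- conjunctions, left and right successor moves are diamonds and boxes.  Every
-- move decreases m + k, so a formula is read off a strategy by well-founded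
-- recursion.  Conversely S wins with the positional strategy that picks any
-- separating formula within the current resources and plays its main
-- connective.

module Submission where

open import Defs
open import Axiom.ExcludedMiddle using (ExcludedMiddle)
open import Data.Bool.Base using (true; false)
open import Data.Empty using (⊥-elim)
open import Data.Maybe.Base using (Maybe; just; nothing)
open import Data.Nat.Base using (ℕ; zero; _≤_; _<_; _+_; _∸_; z≤n; s≤s; s≤s⁻¹)
  renaming (suc to 1+)
open import Data.Nat.Induction using (<-wellFounded)
open import Data.Nat.Properties
open import Data.Product.Base using (∃-syntax; Σ-syntax; _×_; _,_)
open import Data.Sum.Base using (_⊎_; inj₁; inj₂; [_,_])
open import Data.Unit.Base using (tt)
open import Function.Base using (_∘_)
open import Function.Bundles using (_⇔_; mk⇔)
open import Induction.WellFounded using (Acc; acc)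
open import Level using (Level; Lift; lift; lower; suc; _⊔_)
open import Relation.Binary.PropositionalEquality
  using (_≡_; refl; cong; subst; trans)
open import Relation.Nullary using (Dec; yes; no; ¬_; contradiction)
open import Relation.Nullary.Decidable using (map′)
open import Relation.Unary using (_∈_)

-- Arithmetic of the resource bounds.

-- A splitting move divides the resources exactly, while a formula only has to fit below them. The
-- first part gets `i`, and all the surplus goes to the second.
split-sum : ∀ i {j n} → i + j ≤ n → ∃[ j′ ] (j ≤ j′ × i + j′ ≡ n)
split-sum i {j} {n} i+j≤n =
  n ∸ i , m+n≤o⇒m≤o∸n j (subst (_≤ n) (+-comm i j) i+j≤n) ,
  m+[n∸m]≡n (m+n≤o⇒m≤o i i+j≤n)

split-sum+1 : ∀ i {j n} → i + j + 1 ≤ n → ∃[ j′ ] (j ≤ j′ × i + j′ + 1 ≡ n)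
split-sum+1 i {j} le with split-sum i (m+n≤o⇒m≤o∸n (i + j) le)
... | j′ , j≤j′ , eq =
  j′ , j≤j′ , trans (cong (_+ 1) eq) (m∸n+n≡m (m+n≤o⇒n≤o (i + j) le))

m+1≤1+n : ∀ {m n} → m ≤ n → m + 1 ≤ 1+ n
m+1≤1+n {m} {n} m≤n = subst (_≤ 1+ n) (+-comm 1 m) (s≤s m≤n)

m+1≤1+n⁻¹ : ∀ {m n} → m + 1 ≤ 1+ n → m ≤ n
m+1≤1+n⁻¹ {m} {n} = s≤s⁻¹ ∘ subst (_≤ 1+ n) (+-comm m 1)

-- Moves and the formulas they build.

module _ {a ℓ : Level} {Φ : Set a} where

  Solves : ML Φ → Position Φ ℓ → Set (a ⊔ suc ℓ)
  Solves φ ⟨ m , k , A , B ⟩ = ms φ ≤ m × cs φ ≤ k × Separates φ A B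

  Solvable : Position Φ ℓ → Set (a ⊔ suc ℓ)
  Solvable p = ∃[ φ ] Solves φ p

  size : Position Φ ℓ → ℕ
  size ⟨ m , k , _ , _ ⟩ = m + k

  split-decreases₁ : ∀ m₁ m₂ k₁ k₂ → m₁ + k₁ < m₁ + m₂ + (k₁ + k₂ + 1)
  split-decreases₁ m₁ m₂ k₁ k₂ = +-mono-≤-< (m≤m+n m₁ m₂)
    (subst (k₁ <_) (+-comm 1 (k₁ + k₂)) (s≤s (m≤m+n k₁ k₂)))

  split-decreases₂ : ∀ m₁ m₂ k₁ k₂ → m₂ + k₂ < m₁ + m₂ + (k₁ + k₂ + 1)
  split-decreases₂ m₁ m₂ k₁ k₂ = +-mono-≤-< (m≤n+m m₂ m₁)
    (subst (k₂ <_) (+-comm 1 (k₁ + k₂)) (s≤s (m≤n+m k₂ k₁)))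

  -- A split spends one unit of `k` on the connective itself, and a successor move spends one unit
  -- of `m`.
  next-decreases : ∀ {p} (μ : Move p) r → size (next μ r) < size p
  next-decreases (leftSplit m₁ m₂ k₁ k₂ _ _ refl refl _) true =
    split-decreases₁ m₁ m₂ k₁ k₂
  next-decreases (leftSplit m₁ m₂ k₁ k₂ _ _ refl refl _) false =
    split-decreases₂ m₁ m₂ k₁ k₂
  next-decreases (rightSplit m₁ m₂ k₁ k₂ _ _ refl refl _) true =
    split-decreases₁ m₁ m₂ k₁ k₂
  next-decreases (rightSplit m₁ m₂ k₁ k₂ _ _ refl refl _) false =
    split-decreases₂ m₁ m₂ k₁ k₂
  next-decreases (leftSucc _ _)  _ = ≤-refl
  next-decreases (rightSucc _ _) _ = ≤-refl

  no-move-without-resources : {A B : ModelSet Φ ℓ} → ¬ Move ⟨ 0 , 0 , A , B ⟩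
  no-move-without-resources (leftSplit  _ _ k₁ k₂ _ _ _ eq _) = m+1+n≢0 (k₁ + k₂) eq
  no-move-without-resources (rightSplit _ _ k₁ k₂ _ _ _ eq _) = m+1+n≢0 (k₁ + k₂) eq

  won⇒solvable : ∀ {p} → EndsWithSWin p → Solvable p
  won⇒solvable (l , sep) = lit l , z≤n , z≤n , sep

  -- D picks the reply, so a solution is required after each one. The resource paid by the move
  -- covers the cost of the connective or modality that joins or wraps these solutions.
  solvable-before : ∀ {p} (μ : Move p) → (∀ r → Solvable (next μ r)) → Solvable p
  solvable-before (leftSplit _ _ _ _ _ _ refl refl (_ , A⊆)) solve
    with solve true | solve false
  ... | ψ , msψ , csψ , Aψ , Bψ | ϑ , msϑ , csϑ , Aϑ , Bϑ =
    ψ ∨ ϑ , +-mono-≤ msψ msϑ , +-monoˡ-≤ 1 (+-mono-≤ csψ csϑ) ,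
    (λ x x∈A → [ inj₁ ∘ Aψ x , inj₂ ∘ Aϑ x ] (A⊆ x∈A)) ,
    (λ x x∈B → [ Bψ x x∈B , Bϑ x x∈B ])
  solvable-before (rightSplit _ _ _ _ _ _ refl refl (_ , B⊆)) solve
    with solve true | solve false
  ... | ψ , msψ , csψ , Aψ , Bψ | ϑ , msϑ , csϑ , Aϑ , Bϑ =
    ψ ∧ ϑ , +-mono-≤ msψ msϑ , +-monoˡ-≤ 1 (+-mono-≤ csψ csϑ) ,
    (λ x x∈A → Aψ x x∈A , Aϑ x x∈A) ,
    (λ x x∈B (xψ , xϑ) →
      [ (λ x∈B₁ → Bψ x x∈B₁ xψ) , (λ x∈B₂ → Bϑ x x∈B₂ xϑ) ] (B⊆ x∈B))
  solvable-before (leftSucc {A = A} f f-succ) solve with solve tt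
  ... | ψ , msψ , csψ , Aψ , Bψ = ◇ ψ , m+1≤1+n msψ , csψ , left ,
    (λ x x∈B (v , wRv , vψ) → Bψ _ (x , x∈B , succ wRv) vψ)
    where
    left : ∀ x → x ∈ A → x ⊨ ◇ ψ
    -- Abstracting `f x` turns it into a variable, so that `succ` can be matched and the edge read
    -- off.
    left x x∈A with f x | f-succ x x∈A | Aψ (f x) (x , x∈A , refl)
    ... | _ | succ wRv | vψ = _ , wRv , vψ
  solvable-before (rightSucc {B = B} g g-succ) solve with solve tt
  ... | ψ , msψ , csψ , Aψ , Bψ = □ ψ , m+1≤1+n msψ , csψ ,
    (λ x x∈A v wRv → Aψ _ (x , x∈A , succ wRv)) , right
    where
    right : ∀ x → x ∈ B → ¬ (x ⊨ □ ψ)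
    right x x∈B x□ψ with g x | g-succ x x∈B | Bψ (g x) (x , x∈B , refl)
    ... | _ | succ wRv | ¬vψ = ¬vψ (x□ψ _ wRv)

-- From a winning strategy to a formula.

module _ {a ℓ : Level} (em : ExcludedMiddle (a ⊔ suc ℓ)) {Φ : Set a} where

  -- The recursion runs over plays, since `σ` may depend on the history. A play that ends, or where
  -- `σ` gives no move, is complete, so winning supplies a separating literal.
  winning⇒solvable : ∀ {p₀ : Position Φ ℓ} (σ : Strategy p₀) → Winning σ →
                     ∀ {p} (π : Play p₀ p) → Follows σ π → Acc _<_ (size p) →
                     Solvable p
  winning⇒solvable σ win {p} π follows (acc rec) with em {Ended p}
  ... | yes ended = won⇒solvable (win p π follows (inj₁ ended))
  ... | no ¬ended with σ p π in σ≡
  ...   | nothing = won⇒solvable (win p π follows (inj₂ σ≡))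
  ...   | just μ  = solvable-before μ λ r →
    winning⇒solvable σ win (extend π ¬ended μ r) (extend follows ¬ended σ≡ r)
      (rec (next-decreases μ r))

  -- Classical choice of successors.

  decide : (P : Set ℓ) → Dec P
  decide P = map′ lower lift (em {Lift (a ⊔ suc ℓ) P})

  ¬×⇒¬⊎¬ : {P Q : Set ℓ} → ¬ (P × Q) → ¬ P ⊎ ¬ Q
  ¬×⇒¬⊎¬ {P} ¬pq with decide P
  ... | yes p = inj₂ λ q → ¬pq (p , q)
  ... | no ¬p = inj₁ ¬p

  -- Deciding the existential hands over a successor, which makes the choice a function. The default
  -- `x` only serves points where `◇ ψ` fails.
  witness : ML Φ → PointedModel Φ ℓ → PointedModel Φ ℓ
  witness ψ x@(M , _) with decide (x ⊨ ◇ ψ)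
  ... | yes (v , _) = M , v
  ... | no _        = x

  witness-correct : ∀ ψ x → x ⊨ ◇ ψ → witness ψ x ∈ □ₚ x × witness ψ x ⊨ ψ
  witness-correct ψ x x◇ψ with decide (x ⊨ ◇ ψ)
  ... | yes (_ , wRv , vψ) = succ wRv , vψ
  ... | no ¬x◇ψ            = contradiction x◇ψ ¬x◇ψ

  Counterexample : ML Φ → PointedModel Φ ℓ → Set ℓ
  Counterexample ψ (M , w) = Σ[ v ∈ W M ] (R M w v × ¬ ((M , v) ⊨ ψ))

  counterexample : ML Φ → PointedModel Φ ℓ → PointedModel Φ ℓ
  counterexample ψ x@(M , _) with decide (Counterexample ψ x)
  ... | yes (v , _) = M , v
  ... | no _        = x

  counterexample-correct : ∀ ψ x → ¬ (x ⊨ □ ψ) →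
                           counterexample ψ x ∈ □ₚ x × ¬ (counterexample ψ x ⊨ ψ)
  counterexample-correct ψ x@(M , _) ¬x□ψ with decide (Counterexample ψ x)
  ... | yes (_ , wRv , ¬vψ) = succ wRv , ¬vψ
  ... | no none             = contradiction x□ψ ¬x□ψ
    where
    x□ψ : x ⊨ □ ψ
    x□ψ v wRv with decide ((M , v) ⊨ ψ)
    ... | yes vψ = vψ
    ... | no ¬vψ = contradiction (v , wRv , ¬vψ) none

  -- From a formula to a winning strategy.

  Good : Position Φ ℓ → Set (suc (a ⊔ suc ℓ))
  Good p = Σ[ μ ∈ Move p ] (∀ r → Solvable (next μ r))

  solvable⇒won⊎good : ∀ p → Solvable p → EndsWithSWin p ⊎ Good p
  solvable⇒won⊎good _ (lit l , _ , _ , sep) = inj₁ (l , sep)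
  solvable⇒won⊎good ⟨ _ , _ , A , B ⟩ (ψ ∧ ϑ , ms≤ , cs≤ , A⊨ , B⊭)
    with split-sum (ms ψ) ms≤ | split-sum+1 (cs ψ) cs≤
  ... | m₂ , msϑ , m≡ | k₂ , csϑ , k≡ = inj₂
    -- Each point of `B` refutes at least one conjunct, so the two sets cover `B`. They may overlap.
    ( rightSplit (ms ψ) m₂ (cs ψ) k₂
        (λ x → x ∈ B × Lift (a ⊔ suc ℓ) (¬ (x ⊨ ψ)))
        (λ x → x ∈ B × Lift (a ⊔ suc ℓ) (¬ (x ⊨ ϑ)))
        m≡ k≡
        ( (λ { (inj₁ (x∈B , _)) → x∈B ; (inj₂ (x∈B , _)) → x∈B })
        , λ {x} x∈B → [ (λ ¬ψ → inj₁ (x∈B , lift ¬ψ))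
                      , (λ ¬ϑ → inj₂ (x∈B , lift ¬ϑ)) ] (¬×⇒¬⊎¬ (B⊭ x x∈B)))
    , λ { true  → ψ , ≤-refl , ≤-refl
                    , (λ x x∈A → let xψ , _ = A⊨ x x∈A in xψ)
                    , λ { _ (_ , lift ¬ψ) → ¬ψ }
        ; false → ϑ , msϑ , csϑ
                    , (λ x x∈A → let _ , xϑ = A⊨ x x∈A in xϑ)
                    , λ { _ (_ , lift ¬ϑ) → ¬ϑ } })
  solvable⇒won⊎good ⟨ _ , _ , A , B ⟩ (ψ ∨ ϑ , ms≤ , cs≤ , A⊨ , B⊭)
    with split-sum (ms ψ) ms≤ | split-sum+1 (cs ψ) cs≤
  ... | m₂ , msϑ , m≡ | k₂ , csϑ , k≡ = inj₂
    ( leftSplit (ms ψ) m₂ (cs ψ) k₂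
        (λ x → x ∈ A × Lift (a ⊔ suc ℓ) (x ⊨ ψ))
        (λ x → x ∈ A × Lift (a ⊔ suc ℓ) (x ⊨ ϑ))
        m≡ k≡
        ( (λ { (inj₁ (x∈A , _)) → x∈A ; (inj₂ (x∈A , _)) → x∈A })
        , λ {x} x∈A → [ (λ xψ → inj₁ (x∈A , lift xψ))
                      , (λ xϑ → inj₂ (x∈A , lift xϑ)) ] (A⊨ x x∈A))
    , λ { true  → ψ , ≤-refl , ≤-refl
                    , (λ { _ (_ , lift xψ) → xψ })
                    , λ x x∈B → B⊭ x x∈B ∘ inj₁
        ; false → ϑ , msϑ , csϑ
                    , (λ { _ (_ , lift xϑ) → xϑ })
                    , λ x x∈B → B⊭ x x∈B ∘ inj₂ })
  -- A modality costs at least one, so it cannot occur on top when no modal resource is left.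
  solvable⇒won⊎good ⟨ zero , _ , _ , _ ⟩ (◇ ψ , ms≤ , _) =
    contradiction (n≤0⇒n≡0 ms≤) (m+1+n≢0 (ms ψ))
  solvable⇒won⊎good ⟨ zero , _ , _ , _ ⟩ (□ ψ , ms≤ , _) =
    contradiction (n≤0⇒n≡0 ms≤) (m+1+n≢0 (ms ψ))
  solvable⇒won⊎good ⟨ 1+ _ , _ , _ , _ ⟩ (◇ ψ , ms≤ , cs≤ , A⊨ , B⊭) = inj₂
    ( leftSucc (witness ψ)
        (λ x x∈A → let is-succ , _ = witness-correct ψ x (A⊨ x x∈A) in is-succ)
    , λ _ → ψ , m+1≤1+n⁻¹ ms≤ , cs≤
              , (λ { _ (x , x∈A , refl) →
                   let _ , holds = witness-correct ψ x (A⊨ x x∈A) in holds })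
              , λ { _ (x , x∈B , succ wRv) vψ → B⊭ x x∈B (_ , wRv , vψ) })
  solvable⇒won⊎good ⟨ 1+ _ , _ , _ , _ ⟩ (□ ψ , ms≤ , cs≤ , A⊨ , B⊭) = inj₂
    ( rightSucc (counterexample ψ)
        (λ x x∈B →
          let is-succ , _ = counterexample-correct ψ x (B⊭ x x∈B) in is-succ)
    , λ _ → ψ , m+1≤1+n⁻¹ ms≤ , cs≤
              , (λ { _ (x , x∈A , succ wRv) → A⊨ x x∈A _ wRv })
              , λ { _ (x , x∈B , refl) →
                  let _ , fails = counterexample-correct ψ x (B⊭ x x∈B) in fails })

  -- The formula is picked afresh at every position instead of being carried along the play.
  choose : (p : Position Φ ℓ) → Maybe (Move p)
  choose p with em {Solvable p}
  ... | no _      = nothing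
  ... | yes solvable with solvable⇒won⊎good p solvable
  ...   | inj₁ _       = nothing
  ...   | inj₂ (μ , _) = just μ

  choose-keeps-solvable : ∀ p {μ} → choose p ≡ just μ → ∀ r → Solvable (next μ r)
  choose-keeps-solvable p eq r with em {Solvable p}
  ... | yes solvable with solvable⇒won⊎good p solvable
  -- In the other outcomes `choose p` is `nothing`, which contradicts the equation.
  choose-keeps-solvable p refl r | yes _ | inj₂ (_ , good) = good r

  stuck⇒won : ∀ p → Solvable p → choose p ≡ nothing → EndsWithSWin p
  stuck⇒won p solvable eq with em {Solvable p}
  ... | no unsolvable = contradiction solvable unsolvable
  ... | yes solvable′ with solvable⇒won⊎good p solvable′
  ...   | inj₁ won = won

  -- The last move settles it: `choose` only ever moves to positions that are solvable.
  follows⇒solvable : ∀ {p₀} → Solvable p₀ → ∀ {p} {π : Play p₀ p} →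
                     Follows (λ p _ → choose p) π → Solvable p
  follows⇒solvable solvable start            = solvable
  follows⇒solvable _ (extend {p} _ _ eq r) = choose-keeps-solvable p eq r

  -- With both resources at zero no move exists, so a solution can only come from a literal.
  solvable∧ended⇒won : ∀ p → Solvable p → Ended p → EndsWithSWin p
  solvable∧ended⇒won p _ (inj₁ won) = won
  solvable∧ended⇒won p solvable (inj₂ (refl , refl , _)) =
    [ (λ won → won) , (λ (μ , _) → ⊥-elim (no-move-without-resources μ)) ]
      (solvable⇒won⊎good p solvable)

  choose-winning : ∀ {p₀} → Solvable p₀ → Winning {p₀ = p₀} (λ p _ → choose p)
  choose-winning solvable p _ follows =
    [ solvable∧ended⇒won p solvable′ , stuck⇒won p solvable′ ]
    where solvable′ = follows⇒solvable solvable follows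

theorem3p2 : ∀ {a ℓ} → ExcludedMiddle (a ⊔ suc ℓ) →
    {Φ : Set a} (A B : ModelSet Φ ℓ) (m k : ℕ) →
    SHasWinningStrategy (FS m k A B) ⇔
    (∃[ φ ] (ms φ ≤ m × cs φ ≤ k × Separates φ A B))
theorem3p2 em A B m k = mk⇔
  (λ (σ , win) → winning⇒solvable em σ win start start (<-wellFounded (m + k)))
  (λ solvable → (λ p _ → choose em p) , choose-winning em solvable)
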